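{- Let $\lambda$ be an infinite cardinal satisfying $\lambda=\lambda^{\aleph_0}$. Then there exists no universal torsion group of cardinality $\lambda$, i.e. no torsion group $G$ of cardinality $\lambda$ such that every torsion group of cardinality at most $\lambda$ embeds into $G$; and there is not even a torsion group $G$ of cardinality $\lambda$ such that every locally finite group of cardinality at most $\lambda$ embeds into $G$.
   Context: A torsion group is a group all of whose elements have finite order. A group is locally finite if every finitely generated subgroup is finite. "Embeds" means there is an injective group homomorphism. -}

module Defs where

open import Algebra.Bundles using (Group)
open import Algebra.Definitions.RawMonoid using () renaming (_×_ to pow)
open import Algebra.Morphism.Structures using (module GroupMorphisms)
open import Data.Fin.Base using (Fin)
open import Data.Nat.Base using (ℕ; NonZero)
open import Data.Product.Base using (Σ; ∃; _×_; proj₁)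
open import Function.Bundles using (Func; Surjection; Injection; Bijection; _⟨$⟩_)
open import Function.Relation.Binary.Setoid.Equality using (_⇨_)
open import Level using (Level; _⊔_; suc)
open import Relation.Binary.Bundles using (Setoid)
open import Relation.Binary.PropositionalEquality using (setoid)
import Relation.Binary.Construct.On as On
open import Relation.Nullary.Negation.Core using (¬_)

private
  variable
    c ℓ c′ ℓ′ : Level

-- Sets are setoids, so that quotients are available; cardinals are setoids
-- considered up to bijection.

_≃ᶜ_ : Setoid c ℓ → Setoid c′ ℓ′ → Set (c ⊔ ℓ ⊔ c′ ⊔ ℓ′)
A ≃ᶜ B = Bijection A B

_≤ᶜ_ : Setoid c ℓ → Setoid c′ ℓ′ → Set (c ⊔ ℓ ⊔ c′ ⊔ ℓ′)
A ≤ᶜ B = Injection A B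

infix 4 _≃ᶜ_ _≤ᶜ_

Finite : Setoid c ℓ → Set (c ⊔ ℓ)
Finite A = ∃ λ n → setoid (Fin n) ≃ᶜ A

Infinite : Setoid c ℓ → Set (c ⊔ ℓ)
Infinite A = ¬ Finite A

infix 10 _^ℵ₀

_^ℵ₀ : Setoid c ℓ → Setoid (c ⊔ ℓ) ℓ
A ^ℵ₀ = setoid ℕ ⇨ A

-- Every surjection of setoids has a section.  The section must respect the
-- setoid equalities, so this is the set-theoretic axiom of choice and not the
-- choice principle that Agda proves for Σ-types.
AxiomOfChoice : (ℓ : Level) → Set (suc ℓ)
AxiomOfChoice ℓ = {A B : Setoid ℓ ℓ} (f : Surjection A B) →
  Σ (Func B A) λ s → ∀ b → Setoid._≈_ B (Surjection.to f (s ⟨$⟩ b)) b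

∣_∣ : Group c ℓ → Setoid c ℓ
∣ G ∣ = Group.setoid G

Torsion : Group c ℓ → Set (c ⊔ ℓ)
Torsion G = ∀ g → ∃ λ n → NonZero n × (pow rawMonoid n g ≈ ε)
  where open Group G

module _ (G : Group c ℓ) where
  open Group G

  data Generated {k : ℕ} (s : Fin k → Carrier) : Carrier → Set (c ⊔ ℓ) where
    gen  : ∀ i → Generated s (s i)
    unit : Generated s ε
    mul  : ∀ {x y} → Generated s x → Generated s y → Generated s (x ∙ y)
    inv  : ∀ {x} → Generated s x → Generated s (x ⁻¹)
    resp : ∀ {x y} → x ≈ y → Generated s x → Generated s y

  -- Equality of elements ignores the membership proof.
  generatedSubgroup : {k : ℕ} → (Fin k → Carrier) → Setoid (c ⊔ ℓ) ℓ
  generatedSubgroup s = On.setoid (Group.setoid G) (proj₁ {B = Generated s})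

  LocallyFinite : Set (c ⊔ ℓ)
  LocallyFinite = ∀ {k} (s : Fin k → Carrier) → Finite (generatedSubgroup s)

_EmbedsInto_ : Group c ℓ → Group c′ ℓ′ → Set (c ⊔ ℓ ⊔ c′ ⊔ ℓ′)
H EmbedsInto G = ∃ λ f → IsGroupMonomorphism f
  where open GroupMorphisms (Group.rawGroup H) (Group.rawGroup G)

{-# OPTIONS --safe #-}
module Submission where

-- The tree of finite sequences over a torsion group G is permuted by the
-- transpositions x_σ of a node σ with the root and, for every infinite branch
-- η, by an involution y_η exchanging η|n and η|π(n), where π is one of the
-- pairings (1 2)(3 4)⋯ and (2 3)(4 5)⋯.  Then y_η conjugates x_{η|n} to
-- x_{η|π(n)}.  As two branches have only finitely many common nodes, these
-- permutations generate a locally finite group H, whatever pairing is chosen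
-- for each η; and H has at most λ elements because λ = λ^ℵ₀.
--
-- Choose the first pairing for η exactly when no y in G acts in this way on
-- the sequence η(0), η(1), … of elements of G.  An embedding f of H in G
-- determines a branch with η(n) = f(x_{η|n}), on which f(y_η) acts by the
-- chosen pairing, so the first one was not chosen.  But then G has elements
-- acting by both pairings, and their product shifts η(1) ↦ η(3) ↦ η(5) ↦ ⋯,
-- which is impossible in a torsion group.

open import Defs
open import Algebra.Bundles using (Group)
open import Algebra.Morphism.Structures using (module GroupMorphisms)
import Algebra.Properties.Group as GroupProperties
import Algebra.Properties.Monoid.Mult as Mult
open import Axiom.ExcludedMiddle using (ExcludedMiddle)
open import Data.Bool.Base using (Bool; true; false)
open import Data.Fin.Base as Fin using (Fin; toℕ)
import Data.Fin.Properties as Fin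
open import Data.List.Base
  using (List; []; _∷_; _++_; length; map; lookup; foldr; reverse; concat; concatMap;
         tabulate; upTo; deduplicate; cartesianProduct; cartesianProductWith; mapMaybe)
open import Data.List.Properties
  using (length-map; ++-assoc; ++-identityʳ; foldr-++; unfold-reverse; reverse-involutive)
open import Data.List.Membership.Propositional using (_∈_)
import Data.List.Membership.Propositional.Properties as Prop
import Data.List.Membership.Setoid as Membership
import Data.List.Relation.Binary.Equality.Setoid as ListEquality
open import Data.List.Relation.Binary.Pointwise as Pointwise
  using (Pointwise; []; _∷_; Pointwise-length)
open import Data.List.Relation.Unary.All as All using (All; []; _∷_)
import Data.List.Relation.Unary.All.Properties as All
open import Data.List.Relation.Unary.AllPairs using (AllPairs; []; _∷_)
open import Data.List.Relation.Unary.Any as Any using (Any; here; there)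
import Data.List.Relation.Unary.Any.Properties as Any
open import Data.List.Relation.Unary.Enumerates.Setoid using (IsEnumeration)
open import Data.List.Relation.Unary.Enumerates.Setoid.Properties
  using (deduplicate⁺; lookup-surjective)
open import Data.List.Relation.Unary.Unique.DecSetoid.Properties using (deduplicate-!)
open import Data.Maybe.Base using (Maybe; just; nothing)
import Data.Maybe.Relation.Unary.Any as MaybeAny
open import Data.Nat.Base
  using (ℕ; zero; suc; _+_; _*_; _∸_; _⊔_; _≤_; _<_; s≤s; z≤n; NonZero; >-nonZero)
open import Data.Nat.Properties
open import Data.Product.Base using (Σ; ∃; _×_; _,_; proj₁; proj₂)
open import Data.Sum.Base using (_⊎_; inj₁; inj₂)
open import Data.Unit.Polymorphic.Base using (⊤; tt)
open import Function.Base using (_∘_; id)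
open import Function.Bundles using (Bijection; Injection; Surjection; Func; mk⇔; _⟨$⟩_)
open import Level using (Level)
open import Relation.Binary.Bundles using (Setoid; DecSetoid)
open import Relation.Binary.PropositionalEquality as ≡ using (_≡_; _≢_)
import Relation.Binary.Reasoning.Setoid as SetoidReasoning
open import Relation.Nullary using (Dec; yes; no; does)
open import Relation.Nullary.Decidable using (decidable-stable; does-⇔)
open import Relation.Nullary.Negation.Core using (¬_; contradiction)

private
  variable
    a b ℓ ℓ′ : Level

-- Finite setoids

lookup-injective : (A : Setoid a ℓ) → let open Setoid A in
  ∀ {xs} → AllPairs (λ x y → ¬ x ≈ y) xs →
  ∀ {i j} → lookup xs i ≈ lookup xs j → i ≡ j
lookup-injective A (x∉ ∷ u) {Fin.zero}  {Fin.zero}  eq = ≡.refl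
lookup-injective A (x∉ ∷ u) {Fin.zero}  {Fin.suc j} eq =
  contradiction eq (All.lookup x∉ (Prop.∈-lookup j))
lookup-injective A (x∉ ∷ u) {Fin.suc i} {Fin.zero}  eq =
  contradiction (Setoid.sym A eq) (All.lookup x∉ (Prop.∈-lookup i))
lookup-injective A (x∉ ∷ u) {Fin.suc i} {Fin.suc j} eq =
  ≡.cong Fin.suc (lookup-injective A u eq)

module _ {ℓ : Level} (em : ExcludedMiddle ℓ) where

  decSetoid : Setoid ℓ ℓ → DecSetoid ℓ ℓ
  decSetoid A = record
    { isDecEquivalence = record { isEquivalence = Setoid.isEquivalence A ; _≟_ = λ _ _ → em } }

  enumeration⇒finite : (A : Setoid ℓ ℓ) {xs : List (Setoid.Carrier A)} →
    IsEnumeration A xs → Finite A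
  enumeration⇒finite A {xs} enum = length ys , record
    { to        = lookup ys
    ; cong      = λ { ≡.refl → Setoid.refl A }
    ; bijective = lookup-injective A (deduplicate-! (decSetoid A) xs)
                , lookup-surjective A (deduplicate⁺ (decSetoid A) enum)
    }
    where ys = deduplicate (DecSetoid._≟_ (decSetoid A)) xs

  -- A code may name no element or several, but all the elements it names are equal. Excluded middle
  -- picks a representative for every code that names something, and these representatives enumerate
  -- `A`.
  codes⇒finite : (A : Setoid ℓ ℓ) → let open Setoid A in
    {C : Set a} (R : Carrier → C → Set ℓ) →
    (∀ {x y c} → R x c → R y c → x ≈ y) →
    (cs : List C) → (∀ x → Any (R x) cs) → Finite A
  codes⇒finite A {C} R R-inj cs total =
    enumeration⇒finite A {mapMaybe representative cs}
      λ x → Any.mapMaybe⁺ representative cs (Any.map⁺ (Any.map (represented x) (total x)))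
    where
    open Setoid A
    representative : C → Maybe Carrier
    representative c with em {∃ λ x → R x c}
    ... | yes (x , _) = just x
    ... | no _        = nothing
    represented : ∀ x {c} → R x c → MaybeAny.Any (x ≈_) (representative c)
    represented x {c} xRc with em {∃ λ x → R x c}
    ... | yes (_ , yRc) = MaybeAny.just (R-inj xRc yRc)
    ... | no ¬∃         = contradiction (x , xRc) ¬∃

tuples : {A : Set a} → List A → ℕ → List (List A)
tuples xs zero    = [] ∷ []
tuples xs (suc n) = cartesianProductWith _∷_ xs (tuples xs n)

tuples-complete : (A : Setoid a ℓ) → let open Membership A using () renaming (_∈_ to _∈ₛ_) in
  ∀ {xs ys} → All (_∈ₛ xs) ys → Any (Pointwise (Setoid._≈_ A) ys) (tuples xs (length ys))
tuples-complete A []         = here []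
tuples-complete A (y∈ ∷ ys∈) =
  Any.cartesianProductWith⁺ _∷_ _∷_ y∈ (tuples-complete A ys∈)

-- Torsion and locally finite groups

-- If the cyclic subgroup of `g` has `n` elements, two of the powers with exponents from 0 to `n`
-- coincide. Cancelling the one with the smaller exponent leaves a positive exponent that kills `g`.
locallyFinite⇒torsion : (H : Group a ℓ) → LocallyFinite H → Torsion H
locallyFinite⇒torsion H lf g = order (Fin.pigeonhole ≤-refl index)
  where
  open Group H
  open Mult monoid using (×-homo-+) renaming (_×_ to _⊗_)
  open GroupProperties H using (∙-cancelˡ)
  open SetoidReasoning setoid
  open Bijection (lf {1} (λ _ → g) .proj₂)
  power : ∀ n → Generated H {1} (λ _ → g) (n ⊗ g)
  power zero    = unit
  power (suc n) = mul (gen Fin.zero) (power n)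
  index : Fin _ → Fin _
  index i = to⁻ (_ , power (toℕ i))
  order : _ → _
  order (i , j , i<j , eq) = toℕ j ∸ toℕ i , >-nonZero (m<n⇒0<n∸m i<j) ,
    ∙-cancelˡ (toℕ i ⊗ g) _ _ (begin
    (toℕ i ⊗ g) ∙ ((toℕ j ∸ toℕ i) ⊗ g) ≈⟨ ×-homo-+ g (toℕ i) _ ⟨
    (toℕ i + (toℕ j ∸ toℕ i)) ⊗ g   ≡⟨ ≡.cong (_⊗ g) (m+[n∸m]≡n (<⇒≤ i<j)) ⟩
    toℕ j ⊗ g                       ≈⟨ strictlySurjective (_ , power (toℕ j)) .proj₂ ⟨
    to (to⁻ (_ , power (toℕ j))) .proj₁ ≡⟨ ≡.cong (proj₁ ∘ to) eq ⟨
    to (to⁻ (_ , power (toℕ i))) .proj₁ ≈⟨ strictlySurjective (_ , power (toℕ i)) .proj₂ ⟩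
    toℕ i ⊗ g                       ≈⟨ identityʳ _ ⟨
    (toℕ i ⊗ g) ∙ ε                   ∎)

-- Pairings of the natural numbers

swapPairs : ℕ → ℕ
swapPairs zero          = 1
swapPairs (suc zero)    = 0
swapPairs (suc (suc n)) = suc (suc (swapPairs n))

shift : (ℕ → ℕ) → ℕ → ℕ
shift f zero    = zero
shift f (suc n) = suc (f n)

-- The involutions (1 2)(3 4)(5 6)⋯ and (2 3)(4 5)(6 7)⋯.
partner : Bool → ℕ → ℕ
partner false = shift swapPairs
partner true  = shift (shift swapPairs)

module _ where
  open ≡ using (refl; cong)

  shift-involutive : ∀ {f} → (∀ n → f (f n) ≡ n) → ∀ n → shift f (shift f n) ≡ n
  shift-involutive f-inv zero    = refl
  shift-involutive f-inv (suc n) = cong suc (f-inv n)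

  swapPairs-involutive : ∀ n → swapPairs (swapPairs n) ≡ n
  swapPairs-involutive zero          = refl
  swapPairs-involutive (suc zero)    = refl
  swapPairs-involutive (suc (suc n)) = cong (suc ∘ suc) (swapPairs-involutive n)

  partner-involutive : ∀ b n → partner b (partner b n) ≡ n
  partner-involutive false = shift-involutive swapPairs-involutive
  partner-involutive true  = shift-involutive (shift-involutive swapPairs-involutive)

  partner-zero : ∀ b → partner b 0 ≡ 0
  partner-zero false = refl
  partner-zero true  = refl

  shift-lower : ∀ {f} → (∀ n → n ≤ suc (f n)) → ∀ n → n ≤ suc (shift f n)
  shift-lower low zero    = z≤n
  shift-lower low (suc n) = s≤s (low n)

  swapPairs-lower : ∀ n → n ≤ suc (swapPairs n)
  swapPairs-lower zero          = z≤n
  swapPairs-lower (suc zero)    = s≤s z≤n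
  swapPairs-lower (suc (suc n)) = s≤s (s≤s (swapPairs-lower n))

  -- A pairing lowers a level by at most one, so mates of deep nodes are deep.
  partner-lower : ∀ b n → n ≤ suc (partner b n)
  partner-lower false = shift-lower swapPairs-lower
  partner-lower true  = shift-lower (shift-lower swapPairs-lower)

  swapPairs-moves : ∀ n → swapPairs n ≢ n
  swapPairs-moves (suc (suc n)) eq = swapPairs-moves n (suc-injective (suc-injective eq))

  -- The offset is 2 because the pairing `true` fixes 1 as well as 0.
  partner-moves : ∀ b n → partner b (2 + n) ≢ 2 + n
  partner-moves false n eq = swapPairs-moves (suc n) (suc-injective eq)
  partner-moves true  n eq = swapPairs-moves n (suc-injective (suc-injective eq))

  swapPairs-even : ∀ k → swapPairs (k * 2) ≡ suc (k * 2)
  swapPairs-even zero    = refl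
  swapPairs-even (suc k) = cong (suc ∘ suc) (swapPairs-even k)

  -- The first pairing sends `1 + 2k` to `2 + 2k`, and the second sends that to `3 + 2k`. So the
  -- product of the two involutions has an infinite orbit.
  partners-advance : ∀ k → partner true (partner false (suc (k * 2))) ≡ suc (suc k * 2)
  partners-advance k
    rewrite swapPairs-even k | swapPairs-even k = refl

uniformBound : {B : Set a} (Q : B → ℕ → Set b) →
  (∀ {x m n} → m ≤ n → Q x m → Q x n) → (∀ x → ∃ (Q x)) →
  ∀ xs → ∃ λ n → All (λ x → Q x n) xs
uniformBound Q mono bound []       = 0 , []
uniformBound Q mono bound (x ∷ xs) =
  let m , qx = bound x ; n , qxs = uniformBound Q mono bound xs
  in m ⊔ n , mono (m≤m⊔n m n) qx ∷ All.map (mono (m≤n⊔m m n)) qxs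

-- Involutions of a tree

-- The pairing on each branch stays a parameter: local finiteness and the cardinality bound hold for
-- every choice, and only the diagonal argument fixes it. By `pattern-cong` equal branches get the
-- same pairing.
module Tree {ℓ : Level} (em : ExcludedMiddle ℓ) (A : Setoid ℓ ℓ)
  (pattern-of : (ℕ → Setoid.Carrier A) → Bool)
  (pattern-cong : ∀ {η θ} → (∀ n → Setoid._≈_ A (η n) (θ n)) → pattern-of η ≡ pattern-of θ)
  where

  open Setoid A using (_≈_) renaming (Carrier to X)
  open ListEquality A using (_≋_; ≋-refl; ≋-sym; ≋-trans; ≋-reflexive; ≋-setoid)

  infix 20 _↾_
  -- The initial segment of length n, last entry first.
  _↾_ : (ℕ → X) → ℕ → List X
  η ↾ zero  = []
  η ↾ suc n = η n ∷ η ↾ n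

  length-↾ : ∀ η n → length (η ↾ n) ≡ n
  length-↾ η zero    = ≡.refl
  length-↾ η (suc n) = ≡.cong suc (length-↾ η n)

  ↾-length : ∀ {v η n} → v ≋ η ↾ n → length v ≡ n
  ↾-length {η = η} {n} v≋ = ≡.trans (Pointwise-length v≋) (length-↾ η n)

  ↾-injective : ∀ {η θ m n} → η ↾ m ≋ θ ↾ n → m ≡ n
  ↾-injective {η} {m = m} eq = ≡.trans (≡.sym (length-↾ η m)) (↾-length eq)

  ↾-cong : ∀ {η θ} → (∀ n → η n ≈ θ n) → ∀ n → η ↾ n ≋ θ ↾ n
  ↾-cong η≈θ zero    = []
  ↾-cong η≈θ (suc n) = η≈θ n ∷ ↾-cong η≈θ n

  ↾-entries : ∀ {η θ m} n → m < n → η ↾ n ≋ θ ↾ n → η m ≈ θ m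
  ↾-entries {m = m} (suc n) m<1+n (eq ∷ eqs) with m ≟ n
  ... | yes ≡.refl = eq
  ... | no m≢n     = ↾-entries n (≤∧≢⇒< (≤-pred m<1+n) m≢n) eqs

  data Letter : Set ℓ where
    swap : List X → Letter
    flip : (ℕ → X) → Letter

  mate : (ℕ → X) → ℕ → ℕ
  mate η = partner (pattern-of η)

  mate-cong : ∀ {η θ} → (∀ n → η n ≈ θ n) → ∀ n → mate η n ≡ mate θ n
  mate-cong η≈θ n = ≡.cong (λ b → partner b n) (pattern-cong η≈θ)

  mate-involutive : ∀ η n → mate η (mate η n) ≡ n
  mate-involutive η = partner-involutive (pattern-of η)

  On : (ℕ → X) → List X → Set ℓ
  On η v = ∃ λ n → v ≋ η ↾ n

  -- swap σ transposes σ with the root [], so conjugating it by flip η, which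
  -- fixes the root, moves σ along the branch η (see flip-swap).
  ⟦_⟧ : Letter → List X → List X
  ⟦ swap σ ⟧ []      = σ
  ⟦ swap σ ⟧ (x ∷ v) with em {x ∷ v ≋ σ}
  ... | yes _ = []
  ... | no _  = x ∷ v
  ⟦ flip η ⟧ v with em {On η v}
  ... | yes (n , _) = η ↾ mate η n
  ... | no _        = v

  swap-root : ∀ {σ v} → v ≋ [] → ⟦ swap σ ⟧ v ≋ σ
  swap-root [] = ≋-refl

  swap-node : ∀ {σ v} → v ≋ σ → ⟦ swap σ ⟧ v ≋ []
  swap-node {v = []}    [] = []
  swap-node {σ} {x ∷ v} eq with em {x ∷ v ≋ σ}
  ... | yes _  = []
  ... | no neq = contradiction eq neq

  swap-off : ∀ {σ v} → ¬ v ≋ [] → ¬ v ≋ σ → ⟦ swap σ ⟧ v ≡ v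
  swap-off {v = []}    v≉[] v≉σ = contradiction [] v≉[]
  swap-off {σ} {x ∷ v} v≉[] v≉σ with em {x ∷ v ≋ σ}
  ... | yes eq = contradiction eq v≉σ
  ... | no _   = ≡.refl

  flip-on : ∀ {η v n} → v ≋ η ↾ n → ⟦ flip η ⟧ v ≋ η ↾ mate η n
  flip-on {η} {v} {n} eq with em {On η v}
  -- Excluded middle returns some level `m`, which the length of `v` identifies with `n`.
  ... | yes (m , eq′) = ≋-reflexive
    (≡.cong (λ k → η ↾ mate η k) (≡.trans (≡.sym (↾-length eq′)) (↾-length eq)))
  ... | no off        = contradiction (n , eq) off

  flip-off : ∀ {η v} → ¬ On η v → ⟦ flip η ⟧ v ≡ v
  flip-off {η} {v} off with em {On η v}
  ... | yes on = contradiction on off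
  ... | no _   = ≡.refl

  -- The cases `root` and `node` overlap when `σ` is empty. This is harmless, as `swap []` acts as
  -- the identity.
  data SwapView (σ v : List X) : Set ℓ where
    root  : v ≋ [] → SwapView σ v
    node  : v ≋ σ → SwapView σ v
    fixed : ¬ v ≋ [] → ¬ v ≋ σ → SwapView σ v

  swapView : ∀ σ v → SwapView σ v
  swapView σ v with em {v ≋ []} | em {v ≋ σ}
  ... | yes v≋[] | _       = root v≋[]
  ... | no _     | yes v≋σ = node v≋σ
  ... | no v≉[]  | no v≉σ  = fixed v≉[] v≉σ

  ⟦⟧-cong : ∀ l {u v} → u ≋ v → ⟦ l ⟧ u ≋ ⟦ l ⟧ v
  ⟦⟧-cong (swap σ) {u} {v} u≋v with swapView σ u
  ... | root u≋[]       = ≋-trans (swap-root u≋[]) (≋-sym (swap-root (≋-trans (≋-sym u≋v) u≋[])))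
  ... | node u≋σ        = ≋-trans (swap-node u≋σ) (≋-sym (swap-node (≋-trans (≋-sym u≋v) u≋σ)))
  ... | fixed u≉[] u≉σ
    rewrite swap-off u≉[] u≉σ | swap-off (u≉[] ∘ ≋-trans u≋v) (u≉σ ∘ ≋-trans u≋v) = u≋v
  ⟦⟧-cong (flip η) {u} {v} u≋v with em {On η u}
  ... | yes (n , eq) = ≋-sym (flip-on (≋-trans (≋-sym u≋v) eq))
  ... | no off
    rewrite flip-off (λ (n , eq) → off (n , ≋-trans u≋v eq)) = u≋v

  ⟦⟧-involutive : ∀ l v → ⟦ l ⟧ (⟦ l ⟧ v) ≋ v
  ⟦⟧-involutive (swap σ) v with swapView σ v
  ... | root v≋[]  = ≋-trans (swap-node (swap-root v≋[])) (≋-sym v≋[])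
  ... | node v≋σ   = ≋-trans (swap-root (swap-node v≋σ)) (≋-sym v≋σ)
  ... | fixed v≉[] v≉σ rewrite swap-off v≉[] v≉σ | swap-off v≉[] v≉σ = ≋-refl
  ⟦⟧-involutive (flip η) v with em {On η v}
  ... | yes (n , v≋) = ≋-trans (flip-on ≋-refl)
    (≋-trans (≋-reflexive (≡.cong (η ↾_) (mate-involutive η n))) (≋-sym v≋))
  ... | no off rewrite flip-off off = ≋-refl

  flip-root : ∀ {η v} → v ≋ [] → ⟦ flip η ⟧ v ≋ []
  flip-root {η} v≋[] = ≋-trans (flip-on {n = 0} v≋[])
    (≋-reflexive (≡.cong (η ↾_) (partner-zero (pattern-of η))))

  ⟦⟧-transpose : ∀ l {u v} → ⟦ l ⟧ u ≋ v → u ≋ ⟦ l ⟧ v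
  ⟦⟧-transpose l {u} eq = ≋-trans (≋-sym (⟦⟧-involutive l u)) (⟦⟧-cong l eq)

  -- Conjugating a transposition gives the transposition of the images, and `flip η` fixes the root.
  -- This is the relation that an embedding carries over to `G`.
  flip-swap : ∀ η n v →
    ⟦ flip η ⟧ (⟦ swap (η ↾ n) ⟧ v) ≋ ⟦ swap (η ↾ mate η n) ⟧ (⟦ flip η ⟧ v)
  flip-swap η n v with swapView (η ↾ n) v
  ... | root v≋[] = ≋-trans (flip-on (swap-root v≋[])) (≋-sym (swap-root (flip-root v≋[])))
  ... | node v≋   = ≋-trans (flip-root (swap-node v≋)) (≋-sym (swap-node (flip-on v≋)))
  -- Applying the involution `flip η` once more shows that it sends `v` neither to the root nor to
  -- the mate of `η ↾ n`.
  ... | fixed v≉[] v≉ rewrite swap-off v≉[] v≉ = ≋-reflexive (≡.sym (swap-off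
    (λ eq → v≉[] (≋-trans (⟦⟧-transpose (flip η) eq) (flip-root [])))
    (λ eq → v≉ (≋-trans (⟦⟧-transpose (flip η) eq) (≋-trans (flip-on ≋-refl)
      (≋-reflexive (≡.cong (η ↾_) (mate-involutive η n))))))))

  -- The group generated by the involutions

  Word : Set ℓ
  Word = List Letter

  act : Word → List X → List X
  act w v = foldr ⟦_⟧ v w

  act-cong : ∀ w {u v} → u ≋ v → act w u ≋ act w v
  act-cong []      u≋v = u≋v
  act-cong (l ∷ w) u≋v = ⟦⟧-cong l (act-cong w u≋v)

  act-++ : ∀ w w′ v → act (w ++ w′) v ≡ act w (act w′ v)
  act-++ w w′ v = foldr-++ ⟦_⟧ v w w′

  act-reverse : ∀ w v → act (reverse w) (act w v) ≋ v
  act-reverse []      v = ≋-refl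
  act-reverse (l ∷ w) v
    rewrite unfold-reverse l w | act-++ (reverse w) (l ∷ []) (⟦ l ⟧ (act w v)) =
    ≋-trans (act-cong (reverse w) (⟦⟧-involutive l (act w v))) (act-reverse w v)

  act-reverse′ : ∀ w v → act w (act (reverse w) v) ≋ v
  act-reverse′ w v = ≋-trans
    (≋-reflexive (≡.cong (λ w′ → act w′ (act (reverse w) v))
      (≡.sym (reverse-involutive w))))
    (act-reverse (reverse w) v)

  infix 4 _∼_
  _∼_ : Word → Word → Set ℓ
  w ∼ w′ = ∀ v → act w v ≋ act w′ v

  ++-cong : ∀ {w w′ x x′} → w ∼ w′ → x ∼ x′ → w ++ x ∼ w′ ++ x′
  ++-cong {w} {w′} {x} {x′} w∼w′ x∼x′ v rewrite act-++ w x v | act-++ w′ x′ v =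
    ≋-trans (act-cong w (x∼x′ v)) (w∼w′ _)

  reverse-cong : ∀ {w w′} → w ∼ w′ → reverse w ∼ reverse w′
  reverse-cong {w} {w′} w∼w′ v = begin
    act (reverse w) v                             ≈⟨ act-cong (reverse w) (act-reverse′ w′ v) ⟨
    act (reverse w) (act w′ (act (reverse w′) v)) ≈⟨ act-cong (reverse w) (w∼w′ _) ⟨
    act (reverse w) (act w (act (reverse w′) v))  ≈⟨ act-reverse w _ ⟩
    act (reverse w′) v                            ∎
    where open SetoidReasoning ≋-setoid

  -- A permutation group presented by words: equality is equality of actions, and reversal inverts a
  -- word because every letter is an involution.
  treeGroup : Group ℓ ℓ
  treeGroup = record
    { Carrier = Word
    ; _≈_     = _∼_
    ; _∙_     = _++_
    ; ε       = []
    ; _⁻¹     = reverse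
    ; isGroup = record
      { isMonoid = record
        { isSemigroup = record
          { isMagma = record
            { isEquivalence = record
              { refl  = λ v → ≋-refl
              ; sym   = λ eq v → ≋-sym (eq v)
              ; trans = λ eq eq′ v → ≋-trans (eq v) (eq′ v)
              }
            ; ∙-cong = λ {w} {w′} {x} {x′} → ++-cong {w} {w′} {x} {x′}
            }
          ; assoc = λ w x y v → ≋-reflexive (≡.cong (λ w → act w v) (++-assoc w x y))
          }
        ; identity = (λ w v → ≋-refl)
                   , (λ w v → ≋-reflexive (≡.cong (λ w → act w v) (++-identityʳ w)))
        }
      ; inverse = (λ w v → ≋-trans (≋-reflexive (act-++ (reverse w) w v)) (act-reverse w v))
                , (λ w v → ≋-trans (≋-reflexive (act-++ w (reverse w) v)) (act-reverse′ w v))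
      ; ⁻¹-cong = λ {w} {w′} → reverse-cong {w} {w′}
      }
    }

  -- The image of the root recovers the node.
  swap-injective : ∀ {σ τ} → swap σ ∷ [] ∼ swap τ ∷ [] → σ ≋ τ
  swap-injective eq = eq []

  -- Local finiteness

  Settled : Letter → Letter → ℕ → Set ℓ
  Settled (swap σ) _        N = ∀ {v} → v ≋ σ → length v ≤ N
  Settled (flip η) (swap σ) N = ⊤
  Settled (flip η) (flip θ) N = ∀ {n} → N ≤ n → η ↾ n ≋ θ ↾ n → ∀ k → η k ≈ θ k

  settled-mono : ∀ l l′ {m n} → m ≤ n → Settled l l′ m → Settled l l′ n
  settled-mono (swap σ) _        m≤n settled v≋σ = ≤-trans (settled v≋σ) m≤n
  settled-mono (flip η) (swap σ) m≤n settled     = tt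
  settled-mono (flip η) (flip θ) m≤n settled n≤k = settled (≤-trans m≤n n≤k)

  -- There is a level beyond which two letters stop interfering. A swapped node lies at its own
  -- length. Branches that differ at entry `k` have no common node of length above `k`, and equal
  -- branches impose no bound.
  settles : ∀ l l′ → ∃ (Settled l l′)
  settles (swap σ) _        = length σ , λ v≋σ → ≤-reflexive (Pointwise-length v≋σ)
  settles (flip η) (swap σ) = 0 , tt
  settles (flip η) (flip θ) with em {∃ λ k → ¬ η k ≈ θ k}
  ... | yes (k , neq) = suc k , λ {n} k<n eq → contradiction (↾-entries n k<n eq) neq
  ... | no ¬neq       = 0 , λ _ _ k → decidable-stable em (λ neq → ¬neq (k , neq))

  module Finitary (ls : List Letter) where
    private
      settling : ∃ λ N → All (λ (l , l′) → Settled l l′ N) (cartesianProduct ls ls)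
      settling = uniformBound (λ (l , l′) → Settled l l′) (λ {(l , l′)} → settled-mono l l′)
        (λ (l , l′) → settles l l′) (cartesianProduct ls ls)

    N : ℕ
    N = settling .proj₁

    settled : ∀ {l l′} → l ∈ ls → l′ ∈ ls → Settled l l′ N
    settled l∈ l′∈ = All.lookup (settling .proj₂) (Prop.∈-cartesianProduct⁺ l∈ l′∈)

    -- The margin puts the sample level `2 + N` below `bound`, and keeps every level from `bound`
    -- on, together with its mate, above `N`.
    bound : ℕ
    bound = 4 + N

    -- A finite set closed under ls on which a word in ls is determined: a point
    -- outside lies on at most one branch of ls and is moved along it just as the
    -- core point of length 2 + N on that branch.
    data Core (v : List X) : Set ℓ where
      root : v ≋ [] → Core v
      node : ∀ {σ} → swap σ ∈ ls → v ≋ σ → Core v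
      near : ∀ {η n} → flip η ∈ ls → n < bound → v ≋ η ↾ n → Core v
      next : ∀ {η n} → flip η ∈ ls → n < bound → v ≋ η ↾ mate η n → Core v

    Core-resp : ∀ {u v} → u ≋ v → Core u → Core v
    Core-resp u≋v (root eq)          = root (≋-trans (≋-sym u≋v) eq)
    Core-resp u≋v (node σ∈ eq)       = node σ∈ (≋-trans (≋-sym u≋v) eq)
    Core-resp u≋v (near η∈ n< eq) = near η∈ n< (≋-trans (≋-sym u≋v) eq)
    Core-resp u≋v (next η∈ n< eq) = next η∈ n< (≋-trans (≋-sym u≋v) eq)

    mate-large : ∀ η {n} → bound ≤ n → N < mate η n
    mate-large η {n} b≤n =
      ≤-trans (m≤n+m (suc N) 2) (≤-pred (≤-trans b≤n (partner-lower (pattern-of η) n)))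

    -- A core point this deep can only be of kind `next`, as the other kinds lie at levels below
    -- `bound`. Its branch then equals `η` by settledness, so `flip η` returns it to the level below
    -- `bound` from which it came.
    far-core : ∀ {η n v} → flip η ∈ ls → bound ≤ n → v ≋ η ↾ n → Core v → Core (⟦ flip η ⟧ v)
    far-core {η} η∈ b≤n v≋ (root eq)    =
      contradiction (≡.subst (bound ≤_) (↾-injective {η} {η} {n = 0} (≋-trans (≋-sym v≋) eq)) b≤n) λ ()
    far-core η∈ b≤n v≋ (node σ∈ eq) =
      contradiction (≤-trans b≤n (≡.subst (_≤ N) (↾-length v≋) (settled σ∈ η∈ eq)))
        (<⇒≱ (m≤n+m (suc N) 3))
    far-core η∈ b≤n v≋ (near θ∈ m< eq) =
      contradiction b≤n (<⇒≱ (≤-trans (s≤s (≤-reflexive (↾-injective (≋-trans (≋-sym v≋) eq)))) m<))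
    far-core {η} {n} η∈ b≤n v≋ (next {θ} {m} θ∈ m< eq) = near θ∈ m< (begin
      ⟦ flip η ⟧ _          ≈⟨ flip-on v≋ ⟩
      η ↾ mate η n          ≈⟨ ↾-cong η≈θ _ ⟩
      θ ↾ mate η n          ≡⟨ ≡.cong (θ ↾_) (mate-cong η≈θ n) ⟩
      θ ↾ mate θ n          ≡⟨ ≡.cong (λ k → θ ↾ mate θ k) n≡ ⟩
      θ ↾ mate θ (mate θ m) ≡⟨ ≡.cong (θ ↾_) (mate-involutive θ m) ⟩
      θ ↾ m                 ∎)
      where
      open SetoidReasoning ≋-setoid
      n≡ : n ≡ mate θ m
      n≡ = ↾-injective (≋-trans (≋-sym v≋) eq)
      η≈θ : ∀ k → η k ≈ θ k
      η≈θ = settled η∈ θ∈ (≤-trans (m≤n+m N 4) b≤n)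
        (≋-trans (≋-sym v≋) (≋-trans eq (≋-reflexive (≡.cong (θ ↾_) (≡.sym n≡)))))

    ⟦⟧-core : ∀ {l v} → l ∈ ls → Core v → Core (⟦ l ⟧ v)
    ⟦⟧-core {swap σ} {v} l∈ core with swapView σ v
    ... | root v≋[] = node l∈ (swap-root v≋[])
    ... | node v≋σ  = root (swap-node v≋σ)
    ... | fixed v≉[] v≉σ rewrite swap-off v≉[] v≉σ = core
    ⟦⟧-core {flip η} {v} l∈ core with em {On η v}
    ... | no off       = core
    ... | yes (n , v≋) with n <? bound
    ...   | yes n<b = next l∈ n<b ≋-refl
    ...   | no n≮b  = Core-resp (flip-on v≋) (far-core l∈ (≮⇒≥ n≮b) v≋ core)

    act-core : ∀ {w v} → All (_∈ ls) w → Core v → Core (act w v)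
    act-core []        core = core
    act-core (l∈ ∷ w∈) core = ⟦⟧-core l∈ (act-core w∈ core)

    corePoints : List (List X)
    corePoints = [] ∷ concatMap points ls
      where
      points : Letter → List (List X)
      points (swap σ) = σ ∷ []
      points (flip η) = map (η ↾_) (upTo bound) ++ map (λ n → η ↾ mate η n) (upTo bound)

    corePoints⊆Core : All Core corePoints
    corePoints⊆Core = root [] ∷ All.concat⁺ (All.map⁺ (All.tabulate points-core))
      where
      points-core : ∀ {l} → l ∈ ls → All Core _
      points-core {swap σ} l∈ = node l∈ ≋-refl ∷ []
      points-core {flip η} l∈ = All.++⁺
        (All.map⁺ (All.tabulate λ n∈ → near l∈ (Prop.∈-upTo⁻ n∈) ≋-refl))
        (All.map⁺ (All.tabulate λ n∈ → next l∈ (Prop.∈-upTo⁻ n∈) ≋-refl))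

    open Membership ≋-setoid using () renaming (_∈_ to _∈ₗ_)

    Core⊆corePoints : ∀ {v} → Core v → v ∈ₗ corePoints
    Core⊆corePoints (root eq)        = here eq
    Core⊆corePoints (node σ∈ eq)     =
      there (Any.concatMap⁺ _ (Any.map (λ { ≡.refl → here eq }) σ∈))
    Core⊆corePoints (near η∈ n< eq)  = there (Any.concatMap⁺ _ (Any.map
      (λ { ≡.refl → Any.++⁺ˡ (Any.map⁺ (Any.map (λ { ≡.refl → eq }) (Prop.∈-upTo⁺ n<))) }) η∈))
    Core⊆corePoints (next {η} η∈ n< eq) = there (Any.concatMap⁺ _ (Any.map
      (λ { ≡.refl → Any.++⁺ʳ (map (η ↾_) (upTo bound))
        (Any.map⁺ (Any.map (λ { ≡.refl → eq }) (Prop.∈-upTo⁺ n<))) }) η∈))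

    -- Far out on the branch η, a word acts uniformly: trivially or by flip η.
    Trivial Flipping : (ℕ → X) → Word → Set ℓ
    Trivial  η w = ∀ {n} → N < n → N < mate η n → act w (η ↾ n) ≋ η ↾ n
    Flipping η w = ∀ {n} → N < n → N < mate η n → act w (η ↾ n) ≋ η ↾ mate η n

    -- Beyond level `N` there are no swapped nodes, and a branch of `ls` that still meets `η` there
    -- is equal to `η`.
    ⟦⟧-uniform : ∀ {η l} → flip η ∈ ls → l ∈ ls →
      (∀ {n} → N < n → ⟦ l ⟧ (η ↾ n) ≋ η ↾ n) ⊎ (∀ {n} → N < n → ⟦ l ⟧ (η ↾ n) ≋ η ↾ mate η n)
    ⟦⟧-uniform {η} {swap σ} η∈ l∈ = inj₁ λ {n} N<n → ≋-reflexive (swap-off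
      (λ eq → contradiction (≡.subst (N <_) (↾-injective {θ = η} {n = 0} eq) N<n) λ ())
      (λ eq → <⇒≱ N<n (≡.subst (_≤ N) (length-↾ η n) (settled l∈ η∈ eq))))
    ⟦⟧-uniform {η} {flip θ} η∈ l∈ with em {∀ k → η k ≈ θ k}
    ... | yes η≈θ = inj₂ λ {n} _ → ≋-trans (flip-on (↾-cong η≈θ n))
      (≋-trans (≋-sym (↾-cong η≈θ _)) (≋-reflexive (≡.cong (η ↾_) (≡.sym (mate-cong η≈θ n)))))
    ... | no η≉θ  = inj₁ λ {n} N<n → ≋-reflexive (flip-off λ (m , eq) → η≉θ
      (settled η∈ l∈ (<⇒≤ N<n) (≋-trans eq (≋-reflexive (≡.cong (θ ↾_) (≡.sym (↾-injective eq)))))))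

    -- Induction on the word, with two flips cancelling. After a flip the next letter acts at level
    -- `mate η n`, hence the condition that this level too is above `N`.
    act-uniform : ∀ {η w} → flip η ∈ ls → All (_∈ ls) w → Trivial η w ⊎ Flipping η w
    act-uniform η∈ [] = inj₁ λ _ _ → ≋-refl
    act-uniform {η} {l ∷ w} η∈ (l∈ ∷ w∈) with ⟦⟧-uniform η∈ l∈ | act-uniform η∈ w∈
    ... | inj₁ fix | inj₁ triv = inj₁ λ N<n N<m → ≋-trans (⟦⟧-cong l (triv N<n N<m)) (fix N<n)
    ... | inj₁ fix | inj₂ move = inj₂ λ N<n N<m → ≋-trans (⟦⟧-cong l (move N<n N<m)) (fix N<m)
    ... | inj₂ flp | inj₁ triv = inj₂ λ N<n N<m → ≋-trans (⟦⟧-cong l (triv N<n N<m)) (flp N<n)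
    ... | inj₂ flp | inj₂ move = inj₁ λ {n} N<n N<m → ≋-trans (⟦⟧-cong l (move N<n N<m))
      (≋-trans (flp N<m) (≋-reflexive (≡.cong (η ↾_) (mate-involutive η n))))

    act-fixed : ∀ {w v} → All (_∈ ls) w → ¬ Core v → (∀ {η} → flip η ∈ ls → ¬ On η v) →
      act w v ≋ v
    act-fixed [] _ _ = ≋-refl
    act-fixed {swap σ ∷ w} (l∈ ∷ w∈) ¬core off =
      ≋-trans (⟦⟧-cong (swap σ) (act-fixed w∈ ¬core off))
        (≋-reflexive (swap-off (¬core ∘ root) (¬core ∘ node l∈)))
    act-fixed {flip η ∷ w} (l∈ ∷ w∈) ¬core off =
      ≋-trans (⟦⟧-cong (flip η) (act-fixed w∈ ¬core off)) (≋-reflexive (flip-off (off l∈)))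

    AgreeOnCore : Word → Word → Set ℓ
    AgreeOnCore w w′ = ∀ {v} → Core v → act w v ≋ act w′ v

    agree-far : ∀ {w w′ η n} → All (_∈ ls) w → All (_∈ ls) w′ → AgreeOnCore w w′ →
      flip η ∈ ls → bound ≤ n → act w (η ↾ n) ≋ act w′ (η ↾ n)
    agree-far {w} {w′} {η} {n} w∈ w′∈ agree η∈ b≤n =
      conclude (act-uniform η∈ w∈) (act-uniform η∈ w′∈)
      where
      -- A sample level inside the core: it and its mate are above `N`, and either pairing moves it.
      -- So it tells a trivial action from a flipping one, which rules out the mixed cases below.
      p = 2 + N
      N<p : N < p
      N<p = m≤n+m (suc N) 1
      N<mate-p : N < mate η p
      N<mate-p = ≤-pred (partner-lower (pattern-of η) p)
      agree-p : act w (η ↾ p) ≋ act w′ (η ↾ p)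
      agree-p = agree (near η∈ (m≤n+m (suc p) 1) ≋-refl)
      N<n : N < n
      N<n = ≤-trans (m≤n+m (suc N) 3) b≤n
      N<m : N < mate η n
      N<m = mate-large η b≤n
      moved : ¬ (η ↾ mate η p ≋ η ↾ p)
      moved eq = partner-moves (pattern-of η) N (↾-injective eq)
      conclude : Trivial η w ⊎ Flipping η w → Trivial η w′ ⊎ Flipping η w′ →
        act w (η ↾ n) ≋ act w′ (η ↾ n)
      conclude (inj₁ t) (inj₁ t′) = ≋-trans (t N<n N<m) (≋-sym (t′ N<n N<m))
      conclude (inj₂ f) (inj₂ f′) = ≋-trans (f N<n N<m) (≋-sym (f′ N<n N<m))
      conclude (inj₁ t) (inj₂ f′) = contradiction
        (≋-trans (≋-sym (f′ N<p N<mate-p)) (≋-trans (≋-sym agree-p) (t N<p N<mate-p))) moved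
      conclude (inj₂ f) (inj₁ t′) = contradiction
        (≋-trans (≋-sym (f N<p N<mate-p)) (≋-trans agree-p (t′ N<p N<mate-p))) moved

    -- Outside the core, a point off all branches of `ls` is fixed by every letter, and a point on
    -- such a branch has level at least `bound`, where `agree-far` applies.
    core-determines : ∀ {w w′} → All (_∈ ls) w → All (_∈ ls) w′ → AgreeOnCore w w′ → w ∼ w′
    core-determines {w} {w′} w∈ w′∈ agree v
      with em {Core v} | em {∃ λ η → flip η ∈ ls × On η v}
    ... | yes core | _      = agree core
    ... | no ¬core | no off = ≋-trans (act-fixed w∈ ¬core λ η∈ on → off (_ , η∈ , on))
      (≋-sym (act-fixed w′∈ ¬core λ η∈ on → off (_ , η∈ , on)))
    ... | no ¬core | yes (η , η∈ , n , v≋) = ≋-trans (act-cong w v≋)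
      (≋-trans (agree-far w∈ w′∈ agree η∈ (≮⇒≥ λ n<b → ¬core (near η∈ n<b v≋)))
        (≋-sym (act-cong w′ v≋)))

    codes : List (List (List X))
    codes = tuples corePoints (length corePoints)

    Code : Word → List (List X) → Set ℓ
    Code w c = Pointwise _≋_ (map (act w) corePoints) c

    -- The core is mapped to itself, so the images of the core points form one of finitely many
    -- tuples.
    Code-total : ∀ {w} → All (_∈ ls) w → Any (Code w) codes
    Code-total {w} w∈ = ≡.subst (λ n → Any (Code w) (tuples corePoints n))
      (length-map (act w) corePoints)
      (tuples-complete ≋-setoid (All.map⁺
        (All.map (Core⊆corePoints ∘ act-core w∈) corePoints⊆Core)))

    Code-agree : ∀ {w w′ c} → Code w c → Code w′ c → AgreeOnCore w w′
    Code-agree {w} {w′} wc w′c core = agree corePoints wc w′c (Core⊆corePoints core)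
      where
      agree : ∀ ps {v c} → Pointwise _≋_ (map (act w) ps) c → Pointwise _≋_ (map (act w′) ps) c →
        v ∈ₗ ps → act w v ≋ act w′ v
      agree (p ∷ ps) (e ∷ _)  (e′ ∷ _)  (here v≋p) = ≋-trans (act-cong w v≋p)
        (≋-trans e (≋-trans (≋-sym e′) (≋-sym (act-cong w′ v≋p))))
      agree (p ∷ ps) (_ ∷ es) (_ ∷ es′) (there v∈) = agree ps es es′ v∈

  treeGroup-locallyFinite : LocallyFinite treeGroup
  treeGroup-locallyFinite {k} s =
    codes⇒finite em (generatedSubgroup treeGroup s) (λ (_ , g) → Code (normal g .proj₁))
      (λ {(h , g)} {(h′ , g′)} hc h′c v →
        let w , w∈ , h∼w = normal g ; w′ , w′∈ , h′∼w′ = normal g′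
        in ≋-trans (h∼w v) (≋-trans (core-determines w∈ w′∈ (Code-agree {w} {w′} hc h′c) v)
             (≋-sym (h′∼w′ v))))
      codes (λ (_ , g) → Code-total (normal g .proj₂ .proj₁))
    where
    -- Only finitely many letters occur in the generators.
    open Finitary (concat (tabulate s))
    -- Through `resp` the subgroup also contains words with foreign letters. Each is replaced by a
    -- word in the letters of the generators that acts in the same way.
    normal : ∀ {h} → Generated treeGroup s h →
      ∃ λ w → All (_∈ concat (tabulate s)) w × h ∼ w
    normal (gen i) =
      s i , All.tabulate (λ l∈ → Prop.∈-concat⁺′ l∈ (Prop.∈-tabulate⁺ i)) , λ _ → ≋-refl
    normal unit    = [] , [] , λ _ → ≋-refl
    normal (mul {x} {y} g g′) =
      let w , w∈ , eq = normal g ; w′ , w′∈ , eq′ = normal g′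
      in w ++ w′ , All.++⁺ w∈ w′∈ , ++-cong {x} {w} {y} {w′} eq eq′
    normal (inv {x} g) =
      let w , w∈ , eq = normal g
      in reverse w , All.tabulate (All.lookup w∈ ∘ Any.reverse⁻) , reverse-cong {x} {w} eq
    normal (resp x∼y g) =
      let w , w∈ , eq = normal g
      in w , w∈ , λ v → ≋-trans (≋-sym (x∼y v)) (eq v)

  -- The cardinality of the group

  infix 4 _≃_
  data _≃_ : Letter → Letter → Set ℓ where
    swap : ∀ {σ τ} → σ ≋ τ → swap σ ≃ swap τ
    flip : ∀ {η θ} → (∀ n → η n ≈ θ n) → flip η ≃ flip θ

  ⟦⟧-resp-≃ : ∀ {l l′} → l ≃ l′ → ∀ v → ⟦ l ⟧ v ≋ ⟦ l′ ⟧ v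
  ⟦⟧-resp-≃ (swap {σ} σ≋τ) v with swapView σ v
  ... | root v≋[] = ≋-trans (swap-root v≋[]) (≋-trans σ≋τ (≋-sym (swap-root v≋[])))
  ... | node v≋σ  = ≋-trans (swap-node v≋σ) (≋-sym (swap-node (≋-trans v≋σ σ≋τ)))
  ... | fixed v≉[] v≉σ
    rewrite swap-off v≉[] v≉σ | swap-off v≉[] (λ v≋τ → v≉σ (≋-trans v≋τ (≋-sym σ≋τ))) = ≋-refl
  ⟦⟧-resp-≃ (flip {η} {θ} η≈θ) v with em {On η v}
  ... | yes (n , v≋) = ≋-trans (↾-cong η≈θ _) (≋-trans (≋-reflexive (≡.cong (θ ↾_) (mate-cong η≈θ n)))
    (≋-sym (flip-on (≋-trans v≋ (↾-cong η≈θ n)))))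
  ... | no off
    rewrite flip-off (λ (n , v≋) → off (n , ≋-trans v≋ (≋-sym (↾-cong η≈θ n)))) = ≋-refl

  act-resp-≃ : ∀ {w w′} → Pointwise _≃_ w w′ → w ∼ w′
  act-resp-≃ []         v = ≋-refl
  act-resp-≃ {l ∷ w} (l≃l′ ∷ ws) v =
    ≋-trans (⟦⟧-cong l (act-resp-≃ ws v)) (⟦⟧-resp-≃ l≃l′ _)

  module _ (Λ : Setoid ℓ ℓ) where
    private module Λ = Setoid Λ

    module Coding (power : Λ ≃ᶜ Λ ^ℵ₀) {x₀ x₁ : Λ.Carrier} (x₀≉x₁ : ¬ x₀ Λ.≈ x₁)
      (ι : A ≤ᶜ Λ) where

      -- The equation between the cardinal and its countable power stores a whole sequence in one
      -- element. Below, `x₀` and `x₁` in position 0 serve as tags that tell empty from nonempty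
      -- lists and swaps from flips.
      pack : (ℕ → Λ.Carrier) → Λ.Carrier
      pack f = Bijection.to⁻ power (record { to = f ; cong = λ { ≡.refl → Λ.refl } })

      pack-injective : ∀ {f g} → pack f Λ.≈ pack g → ∀ n → f n Λ.≈ g n
      pack-injective {f} {g} eq n = Λ.trans (Λ.sym (Bijection.strictlySurjective power _ .proj₂ n))
        (Λ.trans (Bijection.cong power eq n) (Bijection.strictlySurjective power _ .proj₂ n))

      cons : Λ.Carrier → (ℕ → Λ.Carrier) → ℕ → Λ.Carrier
      cons x f zero    = x
      cons x f (suc n) = f n

      encodeList : {B : Set a} → (B → Λ.Carrier) → List B → Λ.Carrier
      encodeList e []       = pack λ _ → x₀
      encodeList e (b ∷ bs) = pack (cons x₁ (cons (e b) λ _ → encodeList e bs))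

      encodeList-injective : {B : Set a} {e : B → Λ.Carrier} → ∀ bs bs′ →
        encodeList e bs Λ.≈ encodeList e bs′ → Pointwise (λ b b′ → e b Λ.≈ e b′) bs bs′
      encodeList-injective []       []         eq = []
      encodeList-injective []       (b′ ∷ bs′) eq = contradiction (pack-injective eq 0) x₀≉x₁
      encodeList-injective (b ∷ bs) []         eq = contradiction (Λ.sym (pack-injective eq 0)) x₀≉x₁
      encodeList-injective (b ∷ bs) (b′ ∷ bs′) eq =
        pack-injective eq 1 ∷ encodeList-injective bs bs′ (pack-injective eq 2)

      encodeLetter : Letter → Λ.Carrier
      encodeLetter (swap σ) = pack (cons x₀ λ _ → encodeList (Injection.to ι) σ)
      encodeLetter (flip η) = pack (cons x₁ (Injection.to ι ∘ η))

      encodeLetter-injective : ∀ l l′ → encodeLetter l Λ.≈ encodeLetter l′ → l ≃ l′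
      encodeLetter-injective (swap σ) (swap τ) eq =
        swap (Pointwise.map (Injection.injective ι) (encodeList-injective σ τ (pack-injective eq 1)))
      encodeLetter-injective (swap σ) (flip θ) eq = contradiction (pack-injective eq 0) x₀≉x₁
      encodeLetter-injective (flip η) (swap τ) eq = contradiction (Λ.sym (pack-injective eq 0)) x₀≉x₁
      encodeLetter-injective (flip η) (flip θ) eq =
        flip λ n → Injection.injective ι (pack-injective eq (suc n))

      encodeWord-injective : ∀ w w′ →
        encodeList encodeLetter w Λ.≈ encodeList encodeLetter w′ → w ∼ w′
      encodeWord-injective w w′ eq =
        act-resp-≃ (Pointwise.map (encodeLetter-injective _ _) (encodeList-injective w w′ eq))

      -- Different words can spell the same group element and have different codes. Choice fixes one
      -- word for each element, which makes the encoding respect equality.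
      treeGroup-≤ᶜ : AxiomOfChoice ℓ → ∣ treeGroup ∣ ≤ᶜ Λ
      treeGroup-≤ᶜ choice = record
        { to        = λ w → encodeList encodeLetter (section ⟨$⟩ w)
        ; cong      = λ {w} {w′} w∼w′ → Λ.reflexive
            (≡.cong (encodeList encodeLetter) (Func.cong section {w} {w′} w∼w′))
        ; injective = λ {w} {w′} eq v → ≋-trans (≋-sym (isSection w v))
            (≋-trans (encodeWord-injective (section ⟨$⟩ w) (section ⟨$⟩ w′) eq v) (isSection w′ v))
        }
        where
        quotient : Surjection (≡.setoid Word) ∣ treeGroup ∣
        quotient = record
          { to         = id
          ; cong       = λ { ≡.refl _ → ≋-refl }
          ; surjective = λ w → w , λ { ≡.refl _ → ≋-refl }
          }
        section = choice quotient .proj₁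
        isSection = choice quotient .proj₂

-- Universality

-- The power `n ⊗ u` conjugates `ζ 0` to `ζ n`; for `n` with `n ⊗ u` trivial the two coincide.
torsion-conjugation : (G : Group a ℓ) → Torsion G → let open Group G in
  ∀ u (ζ : ℕ → Carrier) → (∀ k → u ∙ ζ k ≈ ζ (suc k) ∙ u) → ∃ λ n → NonZero n × ζ 0 ≈ ζ n
torsion-conjugation G torsion u ζ moves =
  let n , n≢0 , uⁿ≈ε = torsion u in n , n≢0 , (begin
    ζ 0           ≈⟨ identityˡ _ ⟨
    ε ∙ ζ 0       ≈⟨ ∙-congʳ uⁿ≈ε ⟨
    (n ⊗ u) ∙ ζ 0 ≈⟨ power-moves n ⟩
    ζ n ∙ (n ⊗ u) ≈⟨ ∙-congˡ uⁿ≈ε ⟩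
    ζ n ∙ ε       ≈⟨ identityʳ _ ⟩
    ζ n           ∎)
  where
  open Group G
  open Mult monoid using () renaming (_×_ to _⊗_)
  open SetoidReasoning setoid
  power-moves : ∀ n → (n ⊗ u) ∙ ζ 0 ≈ ζ n ∙ (n ⊗ u)
  power-moves zero    = trans (identityˡ _) (sym (identityʳ _))
  power-moves (suc n) = begin
    (u ∙ (n ⊗ u)) ∙ ζ 0     ≈⟨ assoc _ _ _ ⟩
    u ∙ ((n ⊗ u) ∙ ζ 0)     ≈⟨ ∙-congˡ (power-moves n) ⟩
    u ∙ (ζ n ∙ (n ⊗ u))     ≈⟨ assoc _ _ _ ⟨
    (u ∙ ζ n) ∙ (n ⊗ u)     ≈⟨ ∙-congʳ (moves n) ⟩
    (ζ (suc n) ∙ u) ∙ (n ⊗ u) ≈⟨ assoc _ _ _ ⟩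
    ζ (suc n) ∙ (u ∙ (n ⊗ u)) ∎

-- Supplies the two tags for the coding. Without distinct elements, a list of length at most one
-- would enumerate `A`.
infinite⇒distinct : ExcludedMiddle ℓ → (A : Setoid ℓ ℓ) → let open Setoid A in
  Infinite A → ∃ λ x → ∃ λ y → ¬ x ≈ y
infinite⇒distinct em A infinite with em {∃ λ x → ∃ λ y → ¬ Setoid._≈_ A x y}
... | yes distinct = distinct
... | no ¬distinct with em {Setoid.Carrier A}
...   | yes x = contradiction (enumeration⇒finite em A {x ∷ []}
          λ y → here (decidable-stable em λ y≉x → ¬distinct (y , x , y≉x))) infinite
...   | no ¬x = contradiction (enumeration⇒finite em A {[]} λ y → contradiction y ¬x) infinite

-- The diagonal argument

module Diagonal {ℓ : Level} (em : ExcludedMiddle ℓ) (G : Group ℓ ℓ) (torsion : Torsion G) where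
  open Group G

  -- Conjugation by `y` permutes the entries of `η` by the pairing `b`, written without inverses.
  Realised : Bool → (ℕ → Carrier) → Set ℓ
  Realised b η = ∃ λ y → ∀ n → y ∙ η n ≈ η (partner b n) ∙ y

  Realised-cong : ∀ {b η θ} → (∀ n → η n ≈ θ n) → Realised b η → Realised b θ
  Realised-cong η≈θ (y , realises) = y , λ n →
    trans (∙-congˡ (sym (η≈θ n))) (trans (realises n) (∙-congʳ (η≈θ _)))

  -- A pattern that G does not realise on any η with distinct entries.
  pattern-of : (ℕ → Carrier) → Bool
  pattern-of η = does (em {Realised false η})

  pattern-cong : ∀ {η θ} → (∀ n → η n ≈ θ n) → pattern-of η ≡ pattern-of θ
  pattern-cong η≈θ =
    does-⇔ (mk⇔ (Realised-cong {false} η≈θ) (Realised-cong {false} (λ n → sym (η≈θ n)))) em em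

  open Tree em setoid pattern-of pattern-cong public

  -- If y realises false and z realises true, then z ∙ y carries η 1 to η 3,
  -- η 3 to η 5, and so on.
  realised-both : ∀ {η} → Realised false η → Realised true η →
    ∃ λ n → NonZero n × η 1 ≈ η (suc (n * 2))
  realised-both {η} (y , realises-false) (z , realises-true) =
    torsion-conjugation G torsion (z ∙ y) (λ k → η (suc (k * 2))) λ k → begin
      (z ∙ y) ∙ η (suc (k * 2))                              ≈⟨ assoc _ _ _ ⟩
      z ∙ (y ∙ η (suc (k * 2)))                              ≈⟨ ∙-congˡ (realises-false _) ⟩
      z ∙ (η (partner false (suc (k * 2))) ∙ y)              ≈⟨ assoc _ _ _ ⟨
      (z ∙ η (partner false (suc (k * 2)))) ∙ y              ≈⟨ ∙-congʳ (realises-true _) ⟩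
      (η (partner true (partner false (suc (k * 2)))) ∙ z) ∙ y ≈⟨ assoc _ _ _ ⟩
      η (partner true (partner false (suc (k * 2)))) ∙ (z ∙ y)
        ≡⟨ ≡.cong (λ n → η n ∙ (z ∙ y)) (partners-advance k) ⟩
      η (suc (suc k * 2)) ∙ (z ∙ y)                          ∎
    where open SetoidReasoning setoid

  treeGroup-¬embeds : ¬ treeGroup EmbedsInto G
  treeGroup-¬embeds (f , mono) = impossible em (f (flip η ∷ []) , realises)
    where
    open GroupMorphisms.IsGroupMonomorphism mono using (∙-homo; injective)
      renaming (⟦⟧-cong to f-cong)

    -- Each entry of the branch depends on the node formed by the earlier ones, so the initial
    -- segments are built first and `η` is read off from them.
    path : ℕ → List Carrier
    path zero    = []
    path (suc n) = f (swap (path n) ∷ []) ∷ path n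

    η : ℕ → Carrier
    η n = f (swap (path n) ∷ [])

    path≡η↾ : ∀ n → path n ≡ η ↾ n
    path≡η↾ zero    = ≡.refl
    path≡η↾ (suc n) = ≡.cong (η n ∷_) (path≡η↾ n)

    η≡image : ∀ n → η n ≡ f (swap (η ↾ n) ∷ [])
    η≡image n = ≡.cong (λ σ → f (swap σ ∷ [])) (path≡η↾ n)

    realises : ∀ n → f (flip η ∷ []) ∙ η n ≈ η (mate η n) ∙ f (flip η ∷ [])
    realises n = begin
      f (flip η ∷ []) ∙ η n
        ≡⟨ ≡.cong (f (flip η ∷ []) ∙_) (η≡image n) ⟩
      f (flip η ∷ []) ∙ f (swap (η ↾ n) ∷ [])
        ≈⟨ ∙-homo _ _ ⟨
      f (flip η ∷ swap (η ↾ n) ∷ [])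
        ≈⟨ f-cong (flip-swap η n) ⟩
      f (swap (η ↾ mate η n) ∷ flip η ∷ [])
        ≈⟨ ∙-homo _ _ ⟩
      f (swap (η ↾ mate η n) ∷ []) ∙ f (flip η ∷ [])
        ≡⟨ ≡.cong (_∙ f (flip η ∷ [])) (η≡image (mate η n)) ⟨
      η (mate η n) ∙ f (flip η ∷ [])  ∎
      where open SetoidReasoning setoid

    η-injective : ∀ {m n} → η m ≈ η n → m ≡ n
    η-injective {m} {n} eq rewrite η≡image m | η≡image n =
      ↾-injective {η} {η} (swap-injective (injective eq))

    -- Abstracting over the decision that defines `pattern-of η` ties the realised pairing to its
    -- outcome: `no` gives the pairing `false`, which is not realised, and `yes` gives `true`, so
    -- that both are realised.
    impossible : (r? : Dec (Realised false η)) → ¬ Realised (does r?) η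
    impossible (no ¬r) r    = ¬r r
    impossible (yes r) r′ with realised-both r r′
    -- The entries of `η` are distinct, yet entry 1 would equal a later one.
    ... | suc n , _ , eq with () ← η-injective eq

-- The witness is the tree group over `G` itself with the diagonal pattern. Being locally finite,
-- hence torsion, it refutes both kinds of universality.
no-universal : ExcludedMiddle ℓ → AxiomOfChoice ℓ →
  (Λ : Setoid ℓ ℓ) → Infinite Λ → Λ ≃ᶜ Λ ^ℵ₀ →
  (G : Group ℓ ℓ) → Torsion G → ∣ G ∣ ≃ᶜ Λ →
  ∃ λ (H : Group ℓ ℓ) → LocallyFinite H × (∣ H ∣ ≤ᶜ Λ) × ¬ H EmbedsInto G
no-universal em choice Λ infinite power G torsion G≃Λ =
  let _ , _ , distinct = infinite⇒distinct em Λ infinite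
  in treeGroup , treeGroup-locallyFinite
   , Coding.treeGroup-≤ᶜ Λ power distinct (Bijection.injection G≃Λ) choice
   , treeGroup-¬embeds
  where open Diagonal em G torsion

proposition1p4 : {ℓ : Level} → ExcludedMiddle ℓ → AxiomOfChoice ℓ →
    (Λ : Setoid ℓ ℓ) → Infinite Λ → Λ ≃ᶜ Λ ^ℵ₀ →
    (¬ (Σ (Group ℓ ℓ) λ G → Torsion G × (∣ G ∣ ≃ᶜ Λ) ×
    ((H : Group ℓ ℓ) → Torsion H → ∣ H ∣ ≤ᶜ Λ → H EmbedsInto G)))
    ×
    (¬ (Σ (Group ℓ ℓ) λ G → Torsion G × (∣ G ∣ ≃ᶜ Λ) ×
    ((H : Group ℓ ℓ) → LocallyFinite H → ∣ H ∣ ≤ᶜ Λ → H EmbedsInto G)))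
proposition1p4 em choice Λ infinite power =
    (λ (G , torsion , G≃Λ , universal) →
      let H , lf , H≤Λ , ¬embeds = no-universal em choice Λ infinite power G torsion G≃Λ
      in ¬embeds (universal H (locallyFinite⇒torsion H lf) H≤Λ))
  , (λ (G , torsion , G≃Λ , universal) →
      let H , lf , H≤Λ , ¬embeds = no-universal em choice Λ infinite power G torsion G≃Λ
      in ¬embeds (universal H lf H≤Λ))
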